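{- For every integer $n \ge 1$, $R(Q_2, Q_n) \le \frac{5}{3}n + 2$.
   Context: $Q_k$ denotes the Boolean lattice of dimension $k$: the family of all subsets of a $k$-element ground set (e.g. $[k]=\{1,\dots,k\}$), ordered by inclusion. A subposet $Q'$ of a poset $Q$ is a copy of a poset $P$ if there is a bijection $f$ from $P$ to $Q'$ such that $x \le y$ in $P$ if and only if $f(x) \le f(y)$ in $Q$. For posets $P, P'$, the poset Ramsey number $R(P,P')$ is the smallest integer $N$ such that for every coloring of the elements of $Q_N$ in red and blue, there is a copy of $P$ all of whose elements are red or a copy of $P'$ all of whose elements are blue. -}

module Defs where

open import Data.Nat using (ℕ)
open import Data.Bool using (Bool; true; false)
open import Data.Fin.Subset using (Subset; _⊆_)
open import Data.Product using (Σ; _×_)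
open import Relation.Binary.PropositionalEquality using (_≡_)

Q : ℕ → Set
Q k = Subset k

-- A coloring of Q_N: true = red, false = blue.
Coloring : ℕ → Set
Coloring N = Q N → Bool

-- A copy of a poset (A , _≤A_) in Q_N: a map f : A → Q_N with
-- x ≤A y  iff  f x ⊆ f y  (f is then a bijection onto its image Q').
IsCopy : {A : Set} → (A → A → Set) → (N : ℕ) → (A → Q N) → Set
IsCopy {A} _≤A_ N f = ∀ (x y : A) → ((x ≤A y → f x ⊆ f y) × (f x ⊆ f y → x ≤A y))

MonoCopy : (N k : ℕ) → Coloring N → Bool → Set
MonoCopy N k c b = Σ (Q k → Q N) λ f → IsCopy {Q k} _⊆_ N f × (∀ (x : Q k) → c (f x) ≡ b)

Arrows : (N k l : ℕ) → Set
Arrows N k l = ∀ (c : Coloring N) → Data.Sum._⊎_ (MonoCopy N k c true) (MonoCopy N l c false)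
  where import Data.Sum

-- R(Q_k, Q_l) ≤ M : the least N with Q_N → (Q_k, Q_l) exists and is ≤ M,
-- equivalently some N ≤ M satisfies Q_N → (Q_k, Q_l).
RamseyLE : (k l M : ℕ) → Set
RamseyLE k l M = Σ ℕ λ N → (N Data.Nat.≤ M) × Arrows N k l

{-# OPTIONS --safe #-}

-- Split the ground set of Q_{n+k} into X with |X| = n and Y with |Y| = k.  For a
-- linear order on Y with prefixes Y₀ ⊂ Y₁ ⊂ … ⊂ Y_k, either S ↦ S ∪ Y_{h(S)} is a
-- blue copy of Q_n, where h(S) is the maximal length of a red chain
-- S₀ ∪ Y₀ ⊆ S₁ ∪ Y₁ ⊆ … with all Sᵢ ⊆ S, or there is such a red chain reaching Y_k.
-- In the latter case record the pair S₀ ⊆ S_k as a point of {0,1,2}^n.  If two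
-- different orders yield comparable points, then at a level where their prefixes
-- are incomparable they complete a red copy of Q_2, with bottom S₀ taken from the
-- lower chain and top S_k ∪ Y from the upper one.  For k = ⌊2n/3⌋ + 2 the poset
-- {0,1,2}^n is covered by 7·3^(n−3) < k! chains (n ≥ 3), so two such orders exist.

module Submission where

open import Defs
open import Data.Nat using (ℕ; _≤_; _*_; _+_; _/_)
open import Data.Nat using (zero; suc; _<_; _∸_; _⊓_; _!; z≤n; s≤s; ≤′-refl; ≤′-step)
open import Data.Nat.DivMod using (_mod_; m*n/n≡m; /-monoˡ-≤)
open import Data.Nat.Properties
  using ( ≤-refl; ≤-trans; ≤-reflexive; <-≤-trans; ≮⇒≥; m≤n⇒m<n∨m≡n; ≤⇒≤′
        ; *-monoʳ-<; *-monoˡ-≤; *-mono-≤; +-monoʳ-≤; *-assoc; _≤?_; n≤1+n )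
open import Data.Nat.Tactic.RingSolver using (solve-∀)
open import Data.Bool using (true; false)
open import Data.Bool.Properties using (¬-not) renaming (_≟_ to _≟ᵇ_)
open import Data.Empty using (⊥-elim)
open import Data.Fin as Fin using (Fin; zero; suc; toℕ; combine; quotient; remainder)
open import Data.Fin.Patterns using (0F; 1F; 2F)
import Data.Fin.Properties as Finₚ
open import Data.Fin.Subset using (Subset; inside; outside; _⊆_; _⊈_; ⊥; ⊤; ⁅_⁆)
open import Data.Fin.Subset.Properties
  using ( ⊆-refl; ⊆-trans; ⊆⊤; ⊥⊆; drop-∷-⊆; _⊆?_; anySubset?
        ; x∈⁅x⁆; x∈⁅y⁆⇒x≡y )
open import Data.Product using (∃; ∃₂; _×_; _,_; proj₁; proj₂)
open import Data.Sum using (_⊎_; inj₁; inj₂)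
open import Data.Vec using (Vec; []; _∷_; _++_; insertAt; here; there; zipWith)
open import Data.Vec.Relation.Binary.Pointwise.Inductive using (Pointwise; []; _∷_; decidable)
open import Function using (_∘_)
open import Relation.Nullary using (Dec; yes; no; ¬_; contradiction)
open import Relation.Nullary.Decidable using (from-yes; _→-dec_; _⊎-dec_; _×-dec_)
open import Relation.Binary.PropositionalEquality
  using (_≡_; _≢_; refl; sym; trans; cong; cong₂; subst; subst₂)

-- Subsets of a disjoint union

++-mono-⊆ : ∀ {m n} {S S′ : Subset m} {T T′ : Subset n} →
            S ⊆ S′ → T ⊆ T′ → S ++ T ⊆ S′ ++ T′
++-mono-⊆ {S = []} {[]} _ T⊆T′ = T⊆T′
++-mono-⊆ {S = _ ∷ _} {_ ∷ _} S⊆S′ T⊆T′ here with here ← S⊆S′ here = here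
++-mono-⊆ {S = _ ∷ _} {_ ∷ _} S⊆S′ T⊆T′ (there x∈) =
  there (++-mono-⊆ (drop-∷-⊆ S⊆S′) T⊆T′ x∈)

++-cancelʳ-⊆ : ∀ {m n} {S S′ : Subset m} {T T′ : Subset n} → S ++ T ⊆ S′ ++ T′ → S ⊆ S′
++-cancelʳ-⊆ {S = _ ∷ _} {_ ∷ _} sub here with here ← sub here = here
++-cancelʳ-⊆ {S = _ ∷ _} {_ ∷ _} sub (there x∈) = there (++-cancelʳ-⊆ (drop-∷-⊆ sub) x∈)

++-cancelˡ-⊆ : ∀ {m n} (S S′ : Subset m) {T T′ : Subset n} → S ++ T ⊆ S′ ++ T′ → T ⊆ T′
++-cancelˡ-⊆ [] [] sub = sub
++-cancelˡ-⊆ (_ ∷ S) (_ ∷ S′) sub = ++-cancelˡ-⊆ S S′ (drop-∷-⊆ sub)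

insertAt-mono-⊆ : ∀ {n b} {S T : Subset n} j → S ⊆ T → insertAt S j b ⊆ insertAt T j b
insertAt-mono-⊆ zero S⊆T here = here
insertAt-mono-⊆ zero S⊆T (there x∈) = there (S⊆T x∈)
insertAt-mono-⊆ {S = _ ∷ _} {_ ∷ _} (suc j) S⊆T here with here ← S⊆T here = here
insertAt-mono-⊆ {S = _ ∷ _} {_ ∷ _} (suc j) S⊆T (there x∈) =
  there (insertAt-mono-⊆ j (drop-∷-⊆ S⊆T) x∈)

insertAt-cancel-⊆ : ∀ {n b} {S T : Subset n} j → insertAt S j b ⊆ insertAt T j b → S ⊆ T
insertAt-cancel-⊆ zero sub = drop-∷-⊆ sub
insertAt-cancel-⊆ {S = _ ∷ _} {_ ∷ _} (suc j) sub here with here ← sub here = here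
insertAt-cancel-⊆ {S = _ ∷ _} {_ ∷ _} (suc j) sub (there x∈) =
  there (insertAt-cancel-⊆ j (drop-∷-⊆ sub) x∈)

insertAt-⊥ : ∀ {n} (j : Fin (suc n)) → insertAt ⊥ j inside ≡ ⁅ j ⁆
insertAt-⊥ zero = refl
insertAt-⊥ {suc _} (suc j) = cong (outside ∷_) (insertAt-⊥ j)

insertAt-⊤ : ∀ {n} (j : Fin (suc n)) → insertAt ⊤ j inside ≡ ⊤
insertAt-⊤ zero = refl
insertAt-⊤ {suc _} (suc j) = cong (inside ∷_) (insertAt-⊤ j)

⁅⁆-injective-⊆ : ∀ {n} {x y : Fin n} → ⁅ x ⁆ ⊆ ⁅ y ⁆ → x ≡ y
⁅⁆-injective-⊆ {x = x} {y} sub = x∈⁅y⁆⇒x≡y y (sub (x∈⁅x⁆ x))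

-- Linear orders and their prefixes

first : ∀ k → Fin (suc k !) → Fin (suc k)
first k = quotient {suc k} (k !)

rest : ∀ k → Fin (suc k !) → Fin (k !)
rest k = remainder {suc k} (k !)

-- The index a encodes a linear order by its Lehmer code: its first element, and then
-- the order of the remaining k elements.
prefix : ∀ k → Fin (k !) → ℕ → Subset k
prefix zero a i = []
prefix (suc k) a zero = ⊥
prefix (suc k) a (suc i) =
  insertAt (prefix k (rest k a) i) (first k a) inside

prefix-zero : ∀ k a → prefix k a 0 ≡ ⊥
prefix-zero zero a = refl
prefix-zero (suc k) a = refl

prefix-full : ∀ k a → prefix k a k ≡ ⊤
prefix-full zero a = refl
prefix-full (suc k) a =
  trans (cong (λ S → insertAt S (first k a) inside) (prefix-full k (rest k a))) (insertAt-⊤ (first k a))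

prefix-mono : ∀ k a {i j} → i ≤ j → prefix k a i ⊆ prefix k a j
prefix-mono zero a _ = ⊆-refl
prefix-mono (suc k) a z≤n = ⊥⊆
prefix-mono (suc k) a (s≤s i≤j) =
  insertAt-mono-⊆ (first k a) (prefix-mono k _ i≤j)

quotient-remainder-injective : ∀ {m} n {a b : Fin (m * n)} →
  quotient {m} n a ≡ quotient {m} n b → remainder {m} n a ≡ remainder {m} n b → a ≡ b
quotient-remainder-injective {m} n {a} {b} q≡ r≡ =
  trans (sym (Finₚ.combine-remQuot {m} n a)) (trans (cong₂ combine q≡ r≡) (Finₚ.combine-remQuot {m} n b))

-- Common first elements of the two orders are stripped off. Where the orders first differ, the
-- prefixes are distinct singletons, and reinserting the stripped elements keeps them incomparable.
prefix-incomparable : ∀ k {a b : Fin (k !)} → a ≢ b →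
  ∃ λ i → i ≤ k × prefix k a i ⊈ prefix k b i × prefix k b i ⊈ prefix k a i
prefix-incomparable zero {0F} {0F} a≢b = contradiction refl a≢b
prefix-incomparable (suc k) {a} {b} a≢b
  with first k a Finₚ.≟ first k b
... | no q≢ = 1 , s≤s z≤n
            , (λ sub → q≢ (⁅⁆-injective-⊆ (subst₂ _⊆_ (prefix-one a) (prefix-one b) sub)))
            , (λ sub → q≢ (sym (⁅⁆-injective-⊆ (subst₂ _⊆_ (prefix-one b) (prefix-one a) sub))))
  where
  prefix-one : ∀ c → prefix (suc k) c 1 ≡ ⁅ first k c ⁆
  prefix-one c =
    trans (cong (λ S → insertAt S (first k c) inside) (prefix-zero k (rest k c))) (insertAt-⊥ (first k c))
... | yes q≡ =
  let i , i≤k , a⊈b , b⊈a = prefix-incomparable k (a≢b ∘ quotient-remainder-injective {suc k} (k !) q≡)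
  in suc i , s≤s i≤k , a⊈b ∘ cancel q≡ , b⊈a ∘ cancel (sym q≡)
  where
  cancel : ∀ {q q′ : Fin (suc k)} {S T} → q ≡ q′ → insertAt S q inside ⊆ insertAt T q′ inside → S ⊆ T
  cancel {q} refl = insertAt-cancel-⊆ q

-- Red chains and blue copies

-- Since `l` and `r` are incomparable, no further inclusion can hold: `t ⊆ l`, say, would give
-- `r ⊆ t ⊆ l`.
diamond : ∀ {N} {c : Coloring N} {b t : Q N} (l r : Q N) → b ⊆ l → b ⊆ r → l ⊆ t → r ⊆ t →
          l ⊈ r → r ⊈ l → c b ≡ true → c l ≡ true → c r ≡ true → c t ≡ true → MonoCopy N 2 c true
diamond {N} {c} {b} {t} l r b⊆l b⊆r l⊆t r⊆t l⊈r r⊈l cb cl cr ct = f , isCopy , red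
  where
  f : Q 2 → Q N
  f (false ∷ false ∷ []) = b
  f (true  ∷ false ∷ []) = l
  f (false ∷ true  ∷ []) = r
  f (true  ∷ true  ∷ []) = t

  red : ∀ x → c (f x) ≡ true
  red (false ∷ false ∷ []) = cb
  red (true  ∷ false ∷ []) = cl
  red (false ∷ true  ∷ []) = cr
  red (true  ∷ true  ∷ []) = ct

  bottom : ∀ y → b ⊆ f y
  bottom (false ∷ false ∷ []) = ⊆-refl
  bottom (true  ∷ false ∷ []) = b⊆l
  bottom (false ∷ true  ∷ []) = b⊆r
  bottom (true  ∷ true  ∷ []) = ⊆-trans b⊆l l⊆t

  top : ∀ x → f x ⊆ t
  top (false ∷ false ∷ []) = ⊆-trans b⊆l l⊆t
  top (true  ∷ false ∷ []) = l⊆t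
  top (false ∷ true  ∷ []) = r⊆t
  top (true  ∷ true  ∷ []) = ⊆-refl

  mono : ∀ x y → x ⊆ y → f x ⊆ f y
  mono (false ∷ false ∷ []) y _ = bottom y
  mono x (true ∷ true ∷ []) _ = top x
  mono (true ∷ false ∷ []) (true ∷ false ∷ []) _ = ⊆-refl
  mono (false ∷ true ∷ []) (false ∷ true ∷ []) _ = ⊆-refl
  mono (true ∷ _ ∷ []) (false ∷ _ ∷ []) x⊆y with () ← x⊆y here
  mono (_ ∷ true ∷ []) (_ ∷ false ∷ []) x⊆y with there () ← x⊆y (there here)

  reflects : ∀ x y → f x ⊆ f y → x ⊆ y
  reflects (false ∷ false ∷ []) y _ = ⊥⊆
  reflects x (true ∷ true ∷ []) _ = ⊆⊤
  reflects (true ∷ false ∷ []) (true ∷ false ∷ []) _ = ⊆-refl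
  reflects (false ∷ true ∷ []) (false ∷ true ∷ []) _ = ⊆-refl
  reflects (true ∷ false ∷ []) (false ∷ true ∷ []) l⊆r = ⊥-elim (l⊈r l⊆r)
  reflects (true ∷ false ∷ []) (false ∷ false ∷ []) l⊆b = ⊥-elim (l⊈r (⊆-trans l⊆b b⊆r))
  reflects (false ∷ true ∷ []) (true ∷ false ∷ []) r⊆l = ⊥-elim (r⊈l r⊆l)
  reflects (false ∷ true ∷ []) (false ∷ false ∷ []) r⊆b = ⊥-elim (r⊈l (⊆-trans r⊆b b⊆l))
  reflects (true ∷ true ∷ []) (false ∷ false ∷ []) t⊆b = ⊥-elim (l⊈r (⊆-trans l⊆t (⊆-trans t⊆b b⊆r)))
  reflects (true ∷ true ∷ []) (true ∷ false ∷ []) t⊆l = ⊥-elim (r⊈l (⊆-trans r⊆t t⊆l))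
  reflects (true ∷ true ∷ []) (false ∷ true ∷ []) t⊆r = ⊥-elim (l⊈r (⊆-trans l⊆t t⊆r))

  isCopy : IsCopy _⊆_ N f
  isCopy x y = mono x y , reflects x y

module _ {n k} (c : Coloring (n + k)) (Y : ℕ → Subset k) where

  Red : Subset n → ℕ → Set
  Red S i = c (S ++ Y i) ≡ true

  -- The index counts sets, so the top one sits at level `m - 1`. `S` only bounds the chain from
  -- above and need not be red, which makes the predicate monotone in `S`.
  data RedChain : ℕ → Subset n → Set where
    []   : ∀ {S} → RedChain 0 S
    snoc : ∀ {m S T} → T ⊆ S → Red T m → RedChain m T → RedChain (suc m) S

  redChain? : ∀ m S → Dec (RedChain m S)
  redChain? zero S = yes []
  redChain? (suc m) S with anySubset? (λ T → T ⊆? S ×-dec (c (T ++ Y m) ≟ᵇ true) ×-dec redChain? m T)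
  ... | yes (_ , T⊆S , red , chain) = yes (snoc T⊆S red chain)
  ... | no ∄T = no λ { (snoc T⊆S red chain) → ∄T (_ , (λ {x} → T⊆S {x}) , red , chain) }

  widen : ∀ {m S S′} → S ⊆ S′ → RedChain m S → RedChain m S′
  widen S⊆S′ [] = []
  widen S⊆S′ (snoc T⊆S red chain) = snoc (⊆-trans T⊆S S⊆S′) red chain

  shorten : ∀ {m m′ S} → m ≤ m′ → RedChain m′ S → RedChain m S
  shorten = go ∘ ≤⇒≤′
    where
    go : ∀ {m m′ S} → m Data.Nat.≤′ m′ → RedChain m′ S → RedChain m S
    go ≤′-refl chain = chain
    go (≤′-step m≤m′) (snoc T⊆S _ chain) = go m≤m′ (widen T⊆S chain)

  longest : ∀ m {S} → ¬ RedChain m S → ∃ λ h → RedChain h S × ¬ RedChain (suc h) S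
  longest zero ¬chain = contradiction [] ¬chain
  longest (suc m) {S} ¬chain with redChain? m S
  ... | yes chain = m , chain , ¬chain
  ... | no ¬chain′ = longest m ¬chain′

  -- A red `S ++ Y (height S)` would prolong a longest chain inside `S` by `S` itself. Enlarging `S`
  -- cannot lower the height, and the first component of an image recovers `S`.
  blueCopy : (∀ {i j} → i ≤ j → Y i ⊆ Y j) → ∀ m → ¬ RedChain m ⊤ → MonoCopy (n + k) n c false
  blueCopy Y-mono m ¬chain⊤ =
    (λ S → S ++ Y (height S)) ,
    (λ S S′ → (λ S⊆S′ → ++-mono-⊆ S⊆S′ (Y-mono (height-mono S⊆S′))) , ++-cancelʳ-⊆) ,
    (λ S → ¬-not (λ red → proj₂ (proj₂ (maximal S)) (snoc ⊆-refl red (proj₁ (proj₂ (maximal S))))))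
    where
    maximal : ∀ S → ∃ λ h → RedChain h S × ¬ RedChain (suc h) S
    maximal S = longest m (¬chain⊤ ∘ widen ⊆⊤)

    height : Subset n → ℕ
    height S = proj₁ (maximal S)

    height-mono : ∀ {S S′} → S ⊆ S′ → height S ≤ height S′
    height-mono {S} {S′} S⊆S′ = ≮⇒≥ λ h′<h →
      proj₂ (proj₂ (maximal S′)) (widen S⊆S′ (shorten h′<h (proj₁ (proj₂ (maximal S)))))

  -- What a red diamond uses of a chain: its two ends and, at any one level, a red set between them.
  record RedSpan (m : ℕ) : Set where
    field
      low high : Subset n
      red-low  : Red low 0
      red-high : Red high m
      level    : ∀ {i} → i ≤ m → ∃ λ T → low ⊆ T × T ⊆ high × Red T i

    low⊆high : low ⊆ high
    low⊆high = let _ , low⊆T , T⊆high , _ = level z≤n in ⊆-trans low⊆T T⊆high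

  -- The bound on `high` is carried along because the induction needs the old top to lie below the
  -- new set `T`.
  redSpan : ∀ {m S} → RedChain (suc m) S → ∃ λ (R : RedSpan m) → RedSpan.high R ⊆ S
  redSpan {zero} (snoc {T = T} T⊆S red []) =
    record { low = T ; high = T ; red-low = red ; red-high = red
           ; level = λ { z≤n → T , ⊆-refl , ⊆-refl , red } } , T⊆S
  redSpan {suc m} (snoc {T = T} T⊆S red chain) =
    record { low = low ; high = T ; red-low = red-low ; red-high = red ; level = level′ } , T⊆S
    where
    R = redSpan chain
    open RedSpan (proj₁ R)
    level′ : ∀ {i} → i ≤ suc m → ∃ λ U → low ⊆ U × U ⊆ T × Red U i
    level′ i≤1+m with m≤n⇒m<n∨m≡n i≤1+m
    ... | inj₁ (s≤s i≤m) =
      let U , low⊆U , U⊆high , redU = level i≤m in U , low⊆U , ⊆-trans U⊆high (proj₂ R) , redU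
    ... | inj₂ refl = T , ⊆-trans low⊆high (proj₂ R) , ⊆-refl , red

-- Chain covers of {0,1,2}^n

_⊑_ : ∀ {n} → Vec (Fin 3) n → Vec (Fin 3) n → Set
_⊑_ = Pointwise Fin._≤_

ChainCover : ℕ → ℕ → Set
ChainCover n m = ∃ λ (κ : Vec (Fin 3) n → Fin m) → ∀ u v → κ u ≡ κ v → u ⊑ v ⊎ v ⊑ u

chainCover-1 : ChainCover 1 1
chainCover-1 = (λ _ → 0F) , comparable
  where
  comparable : ∀ u v → _ → u ⊑ v ⊎ v ⊑ u
  comparable (x ∷ []) (y ∷ []) _ with Finₚ.≤-total x y
  ... | inj₁ x≤y = inj₁ (x≤y ∷ [])
  ... | inj₂ y≤x = inj₂ (y≤x ∷ [])

-- Each chain is repeated in all three layers of the new coordinate, so only points of one layer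
-- share a label.
chainCover-suc : ∀ {n m} → ChainCover n m → ChainCover (suc n) (3 * m)
chainCover-suc {n} {m} (κ , κ-comparable) = (λ { (x ∷ u) → combine x (κ u) }) , comparable
  where
  comparable : ∀ (u v : Vec (Fin 3) (suc n)) → _ → u ⊑ v ⊎ v ⊑ u
  comparable (x ∷ u) (y ∷ v) eq with refl , κ≡ ← Finₚ.combine-injective x (κ u) y (κ v) eq
    with κ-comparable u v κ≡
  ... | inj₁ u⊑v = inj₁ (≤-refl ∷ u⊑v)
  ... | inj₂ v⊑u = inj₂ (≤-refl ∷ v⊑u)

-- The symmetric chain decomposition: in a grid {0,…,p} × {0,…,q} the hooks
-- min(q-coordinate, p − p-coordinate) = const are chains.  The first two coordinates
-- give the hook s, a chain with 5 − 2s elements on which (x , y) has position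
-- x + y − s; its product with the third coordinate is again cut into hooks t.
chainCover-3 : ChainCover 3 7
chainCover-3 = κ , comparable
  where
  κ : Vec (Fin 3) 3 → Fin 7
  -- For `s` equal to 0 or 1, `t` runs from 0 to 2; for `s` equal to 2 it is 0. So `3 * s + t` is at
  -- most 6 and `mod` identifies no labels.
  κ (x ∷ y ∷ z ∷ []) = (3 * s + t) mod 7
    where
    s = toℕ y ⊓ (2 ∸ toℕ x)
    t = toℕ z ⊓ ((4 ∸ s) ∸ (toℕ x + toℕ y))

  comparable? : ∀ u v → Dec (κ u ≡ κ v → u ⊑ v ⊎ v ⊑ u)
  comparable? u v = (κ u Finₚ.≟ κ v) →-dec (decidable Finₚ._≤?_ u v ⊎-dec decidable Finₚ._≤?_ v u)

  comparable : ∀ u v → κ u ≡ κ v → u ⊑ v ⊎ v ⊑ u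
  comparable (x ∷ y ∷ z ∷ []) (x′ ∷ y′ ∷ z′ ∷ []) =
    from-yes (Finₚ.all? λ x → Finₚ.all? λ y → Finₚ.all? λ z →
              Finₚ.all? λ x′ → Finₚ.all? λ y′ → Finₚ.all? λ z′ →
              comparable? (x ∷ y ∷ z ∷ []) (x′ ∷ y′ ∷ z′ ∷ [])) x y z x′ y′ z′

-- Junk value: trit true false is 2, although it does not arise from A ⊆ B.
trit : Data.Bool.Bool → Data.Bool.Bool → Fin 3
trit true  _     = 2F
trit false true  = 1F
trit false false = 0F

-- For `A ⊆ B`, membership in `A` means digit 2 and membership in `B` means digit at least 1; both
-- conditions are preserved when digits grow.
trits-reflect-⊆ : ∀ {n} {A B A′ B′ : Subset n} → A ⊆ B → A′ ⊆ B′ →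
                  zipWith trit A B ⊑ zipWith trit A′ B′ → A ⊆ A′ × B ⊆ B′
trits-reflect-⊆ {A = []} {[]} {[]} {[]} _ _ _ = ⊆-refl , ⊆-refl
trits-reflect-⊆ {A = a ∷ A} {b ∷ B} {a′ ∷ A′} {b′ ∷ B′} A⊆B A′⊆B′ (t≤t′ ∷ rest) =
  cons (head₁ a b a′ b′ t≤t′) (proj₁ tails) ,
  cons (head₂ a b a′ b′ t≤t′ λ { refl → head A′⊆B′ }) (proj₂ tails)
  where
  tails = trits-reflect-⊆ (drop-∷-⊆ A⊆B) (drop-∷-⊆ A′⊆B′) rest

  head : ∀ {n y} {S T : Subset n} → true ∷ S ⊆ y ∷ T → y ≡ true
  head sub with here ← sub here = refl

  cons : ∀ {n x y} {S T : Subset n} → (x ≡ true → y ≡ true) → S ⊆ T → x ∷ S ⊆ y ∷ T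
  cons x⇒y S⊆T here with refl ← x⇒y refl = here
  cons x⇒y S⊆T (there x∈) = there (S⊆T x∈)

  head₁ : ∀ a b a′ b′ → trit a b Fin.≤ trit a′ b′ → a ≡ true → a′ ≡ true
  head₁ true b true  b′ _ refl = refl
  head₁ true b false true (s≤s ()) refl
  head₁ true b false false () refl

  head₂ : ∀ a b a′ b′ → trit a b Fin.≤ trit a′ b′ → (a′ ≡ true → b′ ≡ true) → b ≡ true → b′ ≡ true
  head₂ a b true b′ _ imp _ = imp refl
  head₂ a b false true _ _ _ = refl
  head₂ true true false false () _ refl
  head₂ false true false false () _ refl

-- The Ramsey property from a chain cover

arrows : ∀ {n m k} → ChainCover n m → m < k ! → Arrows (n + k) 2 n
arrows {n} {m} {k} (κ , κ-comparable) m<k! c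
  -- A chain of `suc k` sets occupies the levels 0 to `k`, hence ends at the full prefix.
  with Finₚ.all? (λ a → redChain? c (prefix k a) (suc k) ⊤)
... | no ¬all =
  let a , ¬chain = Finₚ.¬∀⟶∃¬ _ _ (λ a → redChain? c (prefix k a) (suc k) ⊤) ¬all
  in inj₂ (blueCopy c (prefix k a) (prefix-mono k a) (suc k) ¬chain)
... | yes chains = inj₁ copy
  where
  span : ∀ a → RedSpan c (prefix k a) k
  span a = proj₁ (redSpan c (prefix k a) (chains a))

  module R a = RedSpan (span a)

  pair : Fin (k !) → Vec (Fin 3) n
  pair a = zipWith trit (R.low a) (R.high a)

  redQ₂ : ∀ {a b} → a ≢ b → pair a ⊑ pair b → MonoCopy (n + k) 2 c true
  redQ₂ {a} {b} a≢b a⊑b =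
    let i , i≤k , a⊈b , b⊈a = prefix-incomparable k a≢b
        low⊆low , high⊆high = trits-reflect-⊆ (R.low⊆high a) (R.low⊆high b) a⊑b
        S , a⊆S , S⊆a , redS = R.level a i≤k
        T , b⊆T , T⊆b , redT = R.level b i≤k
    -- The prefixes at levels 0 and `k` are empty and full for every order, so the bottom taken from
    -- `a` and the top taken from `b` fit both chains. The middle sets are incomparable already in
    -- their prefixes.
    in diamond {c = c} (S ++ prefix k a i) (T ++ prefix k b i)
         (++-mono-⊆ a⊆S (prefix-mono k a z≤n))
         (++-mono-⊆ (⊆-trans low⊆low b⊆T) (subst (_⊆ prefix k b i) (sym (prefix-zero k a)) ⊥⊆))
         (++-mono-⊆ (⊆-trans S⊆a high⊆high) (subst (prefix k a i ⊆_) (sym (prefix-full k b)) ⊆⊤))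
         (++-mono-⊆ T⊆b (prefix-mono k b i≤k))
         (a⊈b ∘ ++-cancelˡ-⊆ S T) (b⊈a ∘ ++-cancelˡ-⊆ T S)
         (R.red-low a) redS redT (R.red-high b)

  copy : MonoCopy (n + k) 2 c true
  copy with Finₚ.pigeonhole m<k! (κ ∘ pair)
  ... | a , b , a<b , κ≡ with κ-comparable (pair a) (pair b) κ≡
  ... | inj₁ a⊑b = redQ₂ (Finₚ.<⇒≢ a<b) a⊑b
  ... | inj₂ b⊑a = redQ₂ (Finₚ.<⇒≢ a<b ∘ sym) b⊑a

-- From n to n + 3 the number of chains grows by 27, and k ! by (k + 2)(k + 1) ≥ 30.
chainCover-factorial : ∀ n → ∃₂ λ m k → ChainCover (3 + n) m × m < k ! × 4 ≤ k × k * 3 ≤ 2 * (3 + n) + 6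
-- One base case per residue modulo 3, as `⌊2n/3⌋` grows by exactly 2 when `n` grows by 3.
chainCover-factorial 0 = 7 , 4 , chainCover-3 , from-yes (8 ≤? 24) , from-yes (4 ≤? 4) , from-yes (12 ≤? 12)
chainCover-factorial 1 =
  21 , 4 , chainCover-suc chainCover-3
     , from-yes (22 ≤? 24) , from-yes (4 ≤? 4) , from-yes (12 ≤? 14)
chainCover-factorial 2 =
  63 , 5 , chainCover-suc (chainCover-suc chainCover-3)
     , from-yes (64 ≤? 120) , from-yes (4 ≤? 5) , from-yes (15 ≤? 16)
chainCover-factorial (suc (suc (suc n))) =
  let m , k , cover , m<k! , 4≤k , 3k≤ = chainCover-factorial n
  in 3 * (3 * (3 * m)) , 2 + k , chainCover-suc (chainCover-suc (chainCover-suc cover))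
   , factorial k 4≤k m<k! , ≤-trans 4≤k (≤-trans (n≤1+n k) (n≤1+n _))
   , ≤-trans (+-monoʳ-≤ 6 3k≤) (≤-reflexive (shift n))
  where
  shift : ∀ n → 6 + (2 * (3 + n) + 6) ≡ 2 * (3 + (3 + n)) + 6
  shift = solve-∀

  27m : ∀ m → 27 * m ≡ 3 * (3 * (3 * m))
  27m = solve-∀

  factorial : ∀ k {m} → 4 ≤ k → m < k ! → 3 * (3 * (3 * m)) < (2 + k) !
  factorial k {m} 4≤k m<k! =
    subst₂ _<_ (27m m) (*-assoc (2 + k) (1 + k) (k !))
      (<-≤-trans (*-monoʳ-< 27 m<k!)
        (*-monoˡ-≤ (k !) (≤-trans (from-yes (27 ≤? 30)) (*-mono-≤ (s≤s (s≤s 4≤k)) (s≤s 4≤k)))))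

ramseyLE : ∀ {n m k} → ChainCover n m → m < k ! → k * 3 ≤ 2 * n + 6 → RamseyLE 2 n ((5 * n + 6) / 3)
ramseyLE {n} {m} {k} cover m<k! 3k≤ = n + k , bound , arrows cover m<k!
  where
  left : ∀ n k → n * 3 + k * 3 ≡ (n + k) * 3
  left = solve-∀

  right : ∀ n → n * 3 + (2 * n + 6) ≡ 5 * n + 6
  right = solve-∀

  bound : n + k ≤ (5 * n + 6) / 3
  bound = subst (_≤ (5 * n + 6) / 3) (m*n/n≡m (n + k) 3)
    (/-monoˡ-≤ 3 (subst₂ _≤_ (left n k) (right n) (+-monoʳ-≤ (n * 3) 3k≤)))

theorem4 : ∀ (n : ℕ) → 1 ≤ n → RamseyLE 2 n ((5 * n + 6) / 3)
-- Below dimension 3 the product covers suffice: 1 < 2! and 3 < 3!.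
theorem4 1 _ = ramseyLE {k = 2} chainCover-1 (from-yes (2 ≤? 2)) (from-yes (6 ≤? 8))
theorem4 2 _ = ramseyLE {k = 3} (chainCover-suc chainCover-1) (from-yes (4 ≤? 6)) (from-yes (9 ≤? 10))
theorem4 (suc (suc (suc n))) _ =
  let m , k , cover , m<k! , 4≤k , 3k≤ = chainCover-factorial n in ramseyLE {k = k} cover m<k! 3k≤
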